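{- $\tau(\mathrm{PSG}_5)=36$ and $a(\mathrm{PSG}_5)=5!-\tau(\mathrm{PSG}_5)=84$.
   Context: Two lists $(a_1,\ldots,a_s)$ and $(b_1,\ldots,b_s)$, each with distinct entries, pattern-match if for all $i<j$ we have $a_i<a_j$ if and only if $b_i<b_j$. The pattern-shift graph $\mathrm{PSG}_r$ is the digraph (loops allowed) whose vertices are the permutations of $[r]=\{1,\ldots,r\}$ written as lists, with an edge from $a$ to $b$ (possibly $a=b$) if and only if the list of the last $r-1$ entries of $a$ and the list of the first $r-1$ entries of $b$ pattern-match. For a digraph $G$, $\tau(G)$ is the minimum size of a set of vertices which intersects every directed cycle in $G$, and $a(G)$ is the maximum size of a set of vertices inducing an acyclic subgraph, i.e. one with no directed cycle. Loops count as cycles of length 1, and directed 2-cycles count as cycles. -}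

module Defs where

open import Data.Fin using (Fin; _<_)
open import Data.List using (List; _∷_; []; _++_; applyUpTo; length)
open import Data.List.Membership.Propositional using (_∈_)
open import Data.List.NonEmpty using (List⁺; _∷_; toList)
open import Data.List.Relation.Unary.Any using (Any)
open import Data.List.Relation.Unary.Linked using (Linked)
open import Data.List.Relation.Unary.Unique.Propositional using (Unique)
open import Data.List.Relation.Binary.Permutation.Propositional using (_↭_)
open import Data.Nat as ℕ using (ℕ; suc; NonZero)
open import Data.Product using (_×_; ∃-syntax)
open import Data.Refinement using (Refinement-syntax; value)
open import Data.Vec as Vec using (Vec; lookup; init; tail)
open import Function.Bundles using (_⇔_)
open import Level using (0ℓ)
open import Relation.Binary.Core using (Rel)
open import Relation.Binary.PropositionalEquality using (_≡_)
open import Relation.Nullary using (¬_)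
open import Relation.Unary using (Pred)

record Digraph : Set₁ where
  field
    Vertex : Set
    Edge   : Rel Vertex 0ℓ

open Digraph public

-- v₀ ∷ v₁ ∷ … ∷ vₖ₋₁ (k ≥ 1) stands for v₀ → v₁ → … → vₖ₋₁ → v₀, so a
-- loop is a cycle with k = 1.
IsCycle : (G : Digraph) → List⁺ (Vertex G) → Set
IsCycle G (v ∷ vs) = Unique (v ∷ vs) × Linked (Edge G) (v ∷ vs ++ v ∷ [])

Acyclic : Digraph → Set
Acyclic G = ∀ c → ¬ IsCycle G c

record VertexSet (G : Digraph) : Set where
  field
    elements : List (Vertex G)
    distinct : Unique elements

open VertexSet public

size : ∀ {G} → VertexSet G → ℕ
size S = length (elements S)

HitsAllCycles : (G : Digraph) → VertexSet G → Set
HitsAllCycles G S = ∀ c → IsCycle G c → Any (_∈ elements S) (toList c)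

induced : (G : Digraph) → VertexSet G → Digraph
induced G S .Vertex   = [ v ∈ Vertex G ∣ v ∈ elements S ]
induced G S .Edge u v = Edge G (value u) (value v)

InducesAcyclic : (G : Digraph) → VertexSet G → Set
InducesAcyclic G S = Acyclic (induced G S)

MinimumSize : (G : Digraph) → Pred (VertexSet G) 0ℓ → ℕ → Set
MinimumSize G P n = (∃[ S ] P S × size S ≡ n) × (∀ S → P S → n ℕ.≤ size S)

MaximumSize : (G : Digraph) → Pred (VertexSet G) 0ℓ → ℕ → Set
MaximumSize G P n = (∃[ S ] P S × size S ≡ n) × (∀ S → P S → size S ℕ.≤ n)

infix 1 τ[_]≡_ a[_]≡_

-- τ and a as relations: they determine n uniquely.
τ[_]≡_ : Digraph → ℕ → Set
τ[ G ]≡ n = MinimumSize G (HitsAllCycles G) n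

a[_]≡_ : Digraph → ℕ → Set
a[ G ]≡ n = MaximumSize G (InducesAcyclic G) n

PatternMatch : ∀ {s} → Vec ℕ s → Vec ℕ s → Set
PatternMatch {s} a b = ∀ (i j : Fin s) → i < j →
  (lookup a i ℕ.< lookup a j) ⇔ (lookup b i ℕ.< lookup b j)

-- applyUpTo suc r is the list 1, …, r.
PermutationList : ℕ → Set
PermutationList r = [ a ∈ Vec ℕ r ∣ Vec.toList a ↭ applyUpTo suc r ]

PSG : (r : ℕ) → .{{NonZero r}} → Digraph
PSG r       .Vertex   = PermutationList r
PSG (suc _) .Edge a b = PatternMatch (tail (value a)) (init (value b))

{-# OPTIONS --safe #-}

-- PSG₅ is a line digraph: a permutation of [5] is an arc from the pattern of
-- its first four entries to the pattern of its last four entries.  For any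
-- linear order of the 24 patterns of length four, the arcs that do not go
-- strictly upwards hit all cycles, and there is an order with only 36 such
-- arcs.  Conversely, PSG₅ has 36 pairwise disjoint cycles.  The value of a(PSG₅)
-- follows since, in a finite digraph, a set hits all cycles if and only if its
-- complement induces an acyclic subgraph.

module Submission where

open import Agda.Builtin.FromNat using (Number)
open import Data.Bool using (true; false)
open import Data.Fin as Fin using (Fin; zero; suc)
import Data.Fin.Properties as Fin
open import Data.Irrelevant using ([_])
open import Data.List as List
  using (List; []; _∷_; _++_; applyUpTo; cartesianProductWith; concatMap; filter; length)
open import Data.List.Membership.Propositional using (_∈_; _∉_; mapWith∈)
import Data.List.Membership.DecPropositional as DecMembership
open import Data.List.Membership.Propositional.Properties
  using (∈-allFin; ∈-cartesianProductWith⁺; ∈-cartesianProductWith⁻; ∈-filter⁺; ∈-filter⁻; ∈-∃++)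
open import Data.List.NonEmpty using (List⁺; _∷_; toList)
open import Data.List.Properties
  using (filter-++; filter-some; length-++; length-++-sucʳ; map-++)
open import Data.List.Relation.Binary.Permutation.Propositional
  using (_↭_; ↭-refl; ↭-sym; ↭-trans; prep; swap; module PermutationReasoning)
open import Data.List.Relation.Binary.Permutation.Propositional.Properties using (drop-∷; ∈-resp-↭; shift)
open import Data.List.Relation.Binary.Subset.Propositional using (_⊆_)
open import Data.List.Relation.Unary.All as All using (All; []; _∷_)
open import Data.List.Relation.Unary.All.Properties using (¬Any⇒All¬)
open import Data.List.Relation.Unary.Any as Any using (Any; here; there; any?)
import Data.List.Relation.Unary.Any.Properties as Any
open import Data.List.Relation.Unary.Linked as Linked using (Linked; linked?; [-]; _∷_)
import Data.List.Relation.Unary.Linked.Properties as Linked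
open import Data.List.Relation.Unary.AllPairs using ([]; _∷_)
open import Data.List.Relation.Unary.Unique.Propositional using (Unique)
import Data.List.Relation.Unary.Unique.DecPropositional as DecUnique
import Data.List.Relation.Unary.Unique.Propositional.Properties as Unique
open import Data.Nat as ℕ using (ℕ; zero; suc; _+_; _∸_; _!; _<_; _≤_; _≤?_; _<?_; _/_; _%_; z≤n; s≤s)
import Data.Nat.Properties as ℕ
open import Data.Product using (_×_; _,_; ∃-syntax; proj₂)
open import Data.Refinement as Refinement using (value; value-injective; _,_)
open import Data.Unit using (⊤)
open import Data.Vec as Vec using (Vec; []; _∷_; init; insertAt; lookup; removeAt; tail)
import Data.Vec.Membership.Propositional as Vec using (_∈_)
import Data.Vec.Membership.Propositional.Properties as Vec
import Data.Vec.Properties as Vec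
import Data.Vec.Relation.Unary.Any as VecAny
import Data.Vec.Relation.Unary.Any.Properties as VecAny
open import Function using (_∘_; _on_)
open import Function.Bundles using (_⇔_; mk⇔; Equivalence)
open import Function.Properties.Equivalence using (⇔-isEquivalence)
open import Level using (0ℓ)
open import Relation.Binary.Definitions using (DecidableEquality)
open import Relation.Binary.Structures using (IsEquivalence)
open import Relation.Binary.PropositionalEquality
  using (_≡_; refl; sym; trans; cong; subst; module ≡-Reasoning)
open import Relation.Nullary using (¬_; Dec; contradiction)
open import Relation.Nullary.Decidable
  using (True; does; does-⇔; from-yes; map′; recompute; toWitness; decidable-stable; ¬?; _×-dec_; _→-dec_)
open import Relation.Nullary.Negation using (contradiction-irr)
open import Relation.Unary using (Pred; Decidable)
open import Defs

-- Counting in lists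

-- Pigeonhole: cutting one occurrence of `x` out of `ys` leaves a list that still contains `xs`,
-- since `x` does not recur there.
Unique-⊆⇒length≤ : ∀ {A : Set} {xs ys : List A} → Unique xs → xs ⊆ ys → length xs ≤ length ys
Unique-⊆⇒length≤ []         _     = z≤n
Unique-⊆⇒length≤ {A} {x ∷ xs} (x≢xs ∷ u) xs⊆ys with as , bs , refl ← ∈-∃++ (xs⊆ys (here refl)) = begin
  suc (length xs)         ≤⟨ s≤s (Unique-⊆⇒length≤ u xs⊆as++bs) ⟩
  suc (length (as ++ bs)) ≡⟨ length-++-sucʳ as x bs ⟨
  length (as ++ x ∷ bs)   ∎
  where
  open ℕ.≤-Reasoning
  xs⊆as++bs : xs ⊆ as ++ bs
  xs⊆as++bs y∈xs with ∈-resp-↭ (shift x as bs) (xs⊆ys (there y∈xs))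
  ... | here refl    = contradiction refl (All.lookup x≢xs y∈xs)
  ... | there y∈rest = y∈rest

length-filter-∁ : ∀ {A : Set} {P : Pred A 0ℓ} (P? : Decidable P) xs →
  length (filter P? xs) + length (filter (¬? ∘ P?) xs) ≡ length xs
length-filter-∁ P? [] = refl
length-filter-∁ P? (x ∷ xs) with does (P? x)
... | true  = cong suc (length-filter-∁ P? xs)
... | false = trans (ℕ.+-suc _ _) (cong suc (length-filter-∁ P? xs))

-- Hitting sets and acyclic sets

-- Lower bound for hitting sets: each cycle contributes at least one member of `S` to the
-- concatenation, and uniqueness of the concatenation, which encodes pairwise disjointness, keeps
-- any member from being counted twice.
packing-bound : ∀ {G} (_≟_ : DecidableEquality (Vertex G)) {cs : List (List⁺ (Vertex G))} →
  All (IsCycle G) cs → Unique (concatMap toList cs) → ∀ S → HitsAllCycles G S → length cs ≤ size S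
packing-bound {G} _≟_ {cs} cycles disjoint S hits = begin
  length cs                                  ≤⟨ count cycles ⟩
  length (filter ∈S? (concatMap toList cs))  ≤⟨ Unique-⊆⇒length≤ (Unique.filter⁺ ∈S? disjoint)
                                                  (proj₂ ∘ ∈-filter⁻ ∈S? {xs = concatMap toList cs}) ⟩
  size S                                     ∎
  where
  open ℕ.≤-Reasoning
  open DecMembership _≟_ using (_∈?_)
  ∈S? = _∈? elements S
  count : ∀ {cs} → All (IsCycle G) cs → length cs ≤ length (filter ∈S? (concatMap toList cs))
  count [] = z≤n
  count (_∷_ {c} {cs} cycle cycles)
    rewrite filter-++ ∈S? (toList c) (concatMap toList cs)
          | length-++ (filter ∈S? (toList c)) {filter ∈S? (concatMap toList cs)}
    = ℕ.+-mono-≤ (filter-some ∈S? (hits c cycle)) (count cycles)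

-- With g u = f v on every edge u → v, a cycle on which always f < g would make f increase all the way round.
non-ascent : ∀ {G} {f g : Vertex G → ℕ} → (∀ {u v} → Edge G u v → g u ≡ f v) →
  ∀ c → IsCycle G c → Any (λ v → g v ≤ f v) (toList c)
non-ascent {G} {f} {g} g≡f (v ∷ vs) (_ , linked) =
  -- Comparing naturals is decidable, so a non-ascent can be searched for along the cycle and it
  -- suffices to refute its absence.
  decidable-stable (any? (λ v → g v ≤? f v) (v ∷ vs)) λ ¬any →
    ℕ.<-irrefl refl (last-increasing vs (increasing (v ∷ vs) (¬Any⇒All¬ _ ¬any) linked))
  where
  increasing : ∀ us {w} → All (λ u → ¬ (g u ≤ f u)) us → Linked (Edge G) (us ++ w ∷ []) →
    Linked (_<_ on f) (us ++ w ∷ [])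
  increasing []           []           _       = [-]
  increasing (u ∷ [])     (g≰f ∷ [])   (e ∷ _) = subst (f u <_) (g≡f e) (ℕ.≰⇒> g≰f) ∷ [-]
  increasing (u ∷ _ ∷ _)  (g≰f ∷ rest) (e ∷ l) = subst (f u <_) (g≡f e) (ℕ.≰⇒> g≰f) ∷ increasing _ rest l

  last-increasing : ∀ us {v w} → Linked (_<_ on f) (v ∷ us ++ w ∷ []) → f v < f w
  last-increasing []       (v<w ∷ _) = v<w
  last-increasing (_ ∷ us) (v<u ∷ l) = ℕ.<-trans v<u (last-increasing us l)

-- Serves to lift a cycle of `G` whose vertices all lie in `S` to the induced subgraph, whose
-- vertices are refinements.
unvalue : ∀ {A : Set} {P : Pred A 0ℓ} {xs} → All P xs → ∃[ ys ] List.map (value {P = P}) ys ≡ xs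
unvalue []         = [] , refl
unvalue (px ∷ pxs) with ys , refl ← unvalue pxs = (_ , [ px ]) ∷ ys , refl

module _ {G : Digraph} (S : VertexSet G) where

  -- Distinctness survives because `value` is injective, membership proofs being irrelevant; induced
  -- edges are by definition edges between values. The `map-++` transport accounts for the repeated
  -- closing vertex.
  cycle-value : ∀ u us → IsCycle (induced G S) (u ∷ us) → IsCycle G (value u ∷ List.map value us)
  cycle-value u us (unique , linked) =
    Unique.map⁺ value-injective unique ,
    subst (Linked (Edge G)) (map-++ value (u ∷ us) (u ∷ [])) (Linked.map⁺ linked)

  cycle-unvalue : ∀ u us → IsCycle G (value u ∷ List.map value us) → IsCycle (induced G S) (u ∷ us)
  cycle-unvalue u us (unique , linked) =
    Unique.map⁻ unique ,
    Linked.map⁻ (subst (Linked (Edge G)) (sym (map-++ value (u ∷ us) (u ∷ []))) linked)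

module Complement {G : Digraph} (_≟_ : DecidableEquality (Vertex G))
                  (V : VertexSet G) (∈V : ∀ v → v ∈ elements V) where

  open DecMembership _≟_ using (_∈?_)

  _∉?_ : ∀ v (S : VertexSet G) → Dec (v ∉ elements S)
  v ∉? S = ¬? (v ∈? elements S)

  complement : VertexSet G → VertexSet G
  complement S .elements = filter (_∉? S) (elements V)
  complement S .distinct = Unique.filter⁺ (_∉? S) (distinct V)

  ∈-complement⁺ : ∀ (S : VertexSet G) {v} → v ∉ elements S → v ∈ elements (complement S)
  ∈-complement⁺ S {v} = ∈-filter⁺ (_∉? S) (∈V v)

  ∈-complement⁻ : ∀ (S : VertexSet G) {v} → v ∈ elements (complement S) → v ∉ elements S
  ∈-complement⁻ S = proj₂ ∘ ∈-filter⁻ (_∉? S) {xs = elements V}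

  size≤ : ∀ (S : VertexSet G) → size S ≤ size V
  size≤ S = Unique-⊆⇒length≤ (distinct S) (λ _ → ∈V _)

  size-complement : ∀ (S : VertexSet G) → size (complement S) ≡ size V ∸ size S
  size-complement S = begin
    size (complement S)                       ≡⟨ ℕ.m+n∸m≡n (size S) _ ⟨
    size S + size (complement S) ∸ size S     ≡⟨ cong (λ n → n + size (complement S) ∸ size S) size≡ ⟩
    length V∩S + size (complement S) ∸ size S ≡⟨ cong (_∸ size S) (length-filter-∁ ∈S? (elements V)) ⟩
    size V ∸ size S                           ∎
    where
    open ≡-Reasoning
    ∈S? = _∈? elements S
    V∩S = filter ∈S? (elements V)
    -- Both lists are duplicate-free with the same members, so pigeonhole applies in each direction.
    size≡ : size S ≡ length V∩S
    size≡ = ℕ.≤-antisym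
      (Unique-⊆⇒length≤ (distinct S) (∈-filter⁺ ∈S? (∈V _)))
      (Unique-⊆⇒length≤ (Unique.filter⁺ ∈S? (distinct V)) (proj₂ ∘ ∈-filter⁻ ∈S? {xs = elements V}))

  hits⇒complement-acyclic : ∀ (S : VertexSet G) → HitsAllCycles G S → InducesAcyclic G (complement S)
  hits⇒complement-acyclic S hits (u ∷ us) cycle =
    missed (u ∷ us) (hits _ (cycle-value (complement S) u us cycle))
    where
    missed : ∀ us → ¬ Any (_∈ elements S) (List.map value us)
    -- The membership proof stored in a vertex is irrelevant, so it may only be used to reach a
    -- contradiction.
    missed ((_ , [ u∈ ]) ∷ us) (here u∈S) = contradiction-irr u∈ (λ u∈ → ∈-complement⁻ S u∈ u∈S)
    missed (_ ∷ us) (there any)           = missed us any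

  acyclic⇒complement-hits : ∀ (S : VertexSet G) → InducesAcyclic G S → HitsAllCycles G (complement S)
  acyclic⇒complement-hits S acyclic (v ∷ vs) cycle =
    decidable-stable (any? (_∈? elements (complement S)) (v ∷ vs)) λ ¬any →
      avoids (All.map (λ {v} v∉ → decidable-stable (v ∈? elements S) (v∉ ∘ ∈-complement⁺ S))
        (¬Any⇒All¬ _ ¬any))
    where
    avoids : ¬ All (_∈ elements S) (v ∷ vs)
    avoids all with unvalue all
    ... | u ∷ us , refl = acyclic (u ∷ us) (cycle-unvalue S u us cycle)

  -- Complementation exchanges hitting sets and acyclic sets. A minimum hitting set gives the
  -- witness; the complement of any acyclic `T` hits all cycles, hence has at least `k` elements.
  τ⇒a : ∀ {k} → τ[ G ]≡ k → a[ G ]≡ (size V ∸ k)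
  τ⇒a {k} ((S , hits , refl) , minimal) =
    (complement S , hits⇒complement-acyclic S hits , size-complement S) , maximal
    where
    maximal : ∀ (T : VertexSet G) → InducesAcyclic G T → size T ≤ size V ∸ k
    maximal T acyclic = begin
      -- Truncated subtraction cancels here because `T` is no larger than `V`.
      size T                       ≡⟨ ℕ.m∸[m∸n]≡n (size≤ T) ⟨
      size V ∸ (size V ∸ size T)   ≡⟨ cong (size V ∸_) (size-complement T) ⟨
      size V ∸ size (complement T) ≤⟨ ℕ.∸-monoʳ-≤ (size V) (minimal (complement T) (acyclic⇒complement-hits T acyclic)) ⟩
      size V ∸ k                   ∎
      where open ℕ.≤-Reasoning

-- Enumerating permutations

toList-insertAt-↭ : ∀ {A : Set} {n} (xs : Vec A n) i x → Vec.toList (insertAt xs i x) ↭ x ∷ Vec.toList xs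
toList-insertAt-↭ xs       zero    x = ↭-refl
toList-insertAt-↭ (y ∷ xs) (suc i) x = ↭-trans (prep y (toList-insertAt-↭ xs i x)) (swap y x ↭-refl)

module _ {A : Set} where

  insertion : ∀ {n} → A → Fin (suc n) → Vec A n → Vec A (suc n)
  insertion x i ys = insertAt ys i x

  permutations : ∀ {n} → Vec A n → List (Vec A n)
  permutations []       = [] ∷ []
  permutations (x ∷ xs) = cartesianProductWith (insertion x) (List.allFin _) (permutations xs)

  ∈-permutations⁻ : ∀ {n} (xs : Vec A n) {ys} → ys ∈ permutations xs → Vec.toList ys ↭ Vec.toList xs
  ∈-permutations⁻ []       (here refl) = ↭-refl
  ∈-permutations⁻ (x ∷ xs) ys∈ with ∈-cartesianProductWith⁻ (insertion x) (List.allFin _) (permutations xs) ys∈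
  ... | i , zs , _ , zs∈ , refl = ↭-trans (toList-insertAt-↭ zs i x) (prep x (∈-permutations⁻ xs zs∈))

  -- Locate `x` in `ys` and remove it: cancelling `x` shows that the remainder permutes `xs`, and
  -- reinserting `x` at the same index restores `ys`.
  ∈-permutations⁺ : ∀ {n} (xs ys : Vec A n) → Vec.toList ys ↭ Vec.toList xs → ys ∈ permutations xs
  ∈-permutations⁺ []       []     _ = here refl
  ∈-permutations⁺ (x ∷ xs) ys ys↭ = subst (_∈ permutations (x ∷ xs)) insert-remove
    (∈-cartesianProductWith⁺ (insertion x) (∈-allFin i) (∈-permutations⁺ xs zs (drop-∷ (begin
      x ∷ Vec.toList zs            ↭⟨ toList-insertAt-↭ zs i x ⟨
      Vec.toList (insertAt zs i x) ≡⟨ cong Vec.toList insert-remove ⟩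
      Vec.toList ys                ↭⟨ ys↭ ⟩
      x ∷ Vec.toList xs            ∎))))
    where
    open PermutationReasoning
    x∈ys : x Vec.∈ ys
    x∈ys = Vec.∈-toList⁻ (∈-resp-↭ (↭-sym ys↭) (here refl))
    i  = VecAny.index x∈ys
    zs = removeAt ys i
    insert-remove : insertAt zs i x ≡ ys
    insert-remove = trans (cong (insertAt zs i) (VecAny.lookup-index x∈ys)) (Vec.insertAt-removeAt ys i)

one-to : ∀ r → Vec ℕ r
one-to r = Vec.tabulate (suc ∘ Fin.toℕ)

toList-tabulate : ∀ {A : Set} n (f : ℕ → A) → Vec.toList (Vec.tabulate {n = n} (f ∘ Fin.toℕ)) ≡ applyUpTo f n
toList-tabulate zero    f = refl
toList-tabulate (suc n) f = cong (f 0 ∷_) (toList-tabulate n (f ∘ suc))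

_≟ⱽ_ : ∀ {n} → DecidableEquality (Vec ℕ n)
_≟ⱽ_ = Vec.≡-dec ℕ._≟_

-- Membership in the finite enumeration is decidable and equivalent to being a permutation.
permutationList? : ∀ {r} (a : Vec ℕ r) → Dec (Vec.toList a ↭ applyUpTo suc r)
permutationList? {r} a = map′
  (subst (Vec.toList a ↭_) (toList-tabulate r suc) ∘ ∈-permutations⁻ (one-to r))
  (∈-permutations⁺ (one-to r) a ∘ subst (Vec.toList a ↭_) (sym (toList-tabulate r suc)))
  (a ∈? permutations (one-to r))
  where open DecMembership _≟ⱽ_ using (_∈?_)

permutationLists : ∀ r → List (PermutationList r)
permutationLists r = mapWith∈ (permutations (one-to r)) λ {a} a∈ →
  a , [ subst (Vec.toList a ↭_) (toList-tabulate r suc) (∈-permutations⁻ (one-to r) a∈) ]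

∈-permutationLists : ∀ {r} (a : PermutationList r) → a ∈ permutationLists r
∈-permutationLists {r} (a , [ a↭ ]) = Any.mapWith∈⁺ _ (a , a∈ , refl)
  where
  a∈ : a ∈ permutations (one-to r)
  -- The proof inside the refinement is irrelevant; decidability allows `recompute` to rebuild a
  -- usable one.
  a∈ = ∈-permutations⁺ (one-to r) a
    (subst (Vec.toList a ↭_) (sym (toList-tabulate r suc)) (recompute (permutationList? a) a↭))

_≟ᴾ_ : ∀ {r} → DecidableEquality (PermutationList r)
_≟ᴾ_ = Refinement._≟_ _≟ⱽ_

-- Pattern matching

module _ {s : ℕ} where

  patternMatch? : (a b : Vec ℕ s) → Dec (PatternMatch a b)
  patternMatch? a b = Fin.all? λ i → Fin.all? λ j → (i Fin.<? j) →-dec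
    ((lookup a i <? lookup a j) ⇔-dec (lookup b i <? lookup b j))
    where
    _⇔-dec_ : ∀ {A B : Set} → Dec A → Dec B → Dec (A ⇔ B)
    a? ⇔-dec b? = map′ (λ (f , g) → mk⇔ f g) (λ e → Equivalence.to e , Equivalence.from e)
      ((a? →-dec b?) ×-dec (b? →-dec a?))

  PatternMatch-sym : (a b : Vec ℕ s) → PatternMatch a b → PatternMatch b a
  PatternMatch-sym a b a~b i j i<j = IsEquivalence.sym ⇔-isEquivalence (a~b i j i<j)

  PatternMatch-trans : (a b c : Vec ℕ s) → PatternMatch a b → PatternMatch b c → PatternMatch a c
  PatternMatch-trans a b c a~b b~c i j i<j = IsEquivalence.trans ⇔-isEquivalence (a~b i j i<j) (b~c i j i<j)

  -- Equals length ps if no member of ps pattern-matches a.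
  rank : List (Vec ℕ s) → Vec ℕ s → ℕ
  rank []       a = 0
  rank (p ∷ ps) a with does (patternMatch? a p)
  ... | true  = 0
  ... | false = suc (rank ps a)

  -- Matching is an equivalence relation, so `a` and `b` match the same members of `ps` and the two
  -- scans stop together. Hence rank depends only on the pattern.
  rank-cong : ∀ ps (a b : Vec ℕ s) → PatternMatch a b → rank ps a ≡ rank ps b
  rank-cong []       a b _ = refl
  rank-cong (p ∷ ps) a b a~b
    with does (patternMatch? a p) | does (patternMatch? b p) | does-⇔
      (mk⇔ (PatternMatch-trans b a p (PatternMatch-sym a b a~b)) (PatternMatch-trans a b p a~b))
      (patternMatch? a p) (patternMatch? b p)
  ... | true  | true  | _ = refl
  ... | true  | false | ()
  ... | false | true  | ()
  ... | false | false | _ = cong suc (rank-cong ps a b a~b)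

edge? : ∀ {r} (a b : PermutationList (suc r)) → Dec (Edge (PSG (suc r)) a b)
edge? a b = patternMatch? (tail (value a)) (init (value b))

isCycle? : ∀ {r} (c : List⁺ (PermutationList (suc r))) → Dec (IsCycle (PSG (suc r)) c)
isCycle? (v ∷ vs) = unique? (v ∷ vs) ×-dec linked? edge? (v ∷ vs ++ v ∷ [])
  where open DecUnique _≟ᴾ_ using (unique?)

-- The case r = 5

-- A list of digits is written as a decimal numeral.
digits : ∀ n → ℕ → Vec ℕ n
digits zero    m = []
digits (suc n) m = digits n (m / 10) Vec.∷ʳ (m % 10)

module Numerals where

  open import Agda.Builtin.FromNat using (fromNat) public

  instance
    pattern-numeral : ∀ {n} → Number (Vec ℕ n)
    pattern-numeral {n} = record { Constraint = λ _ → ⊤ ; fromNat = λ m → digits n m }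

    permutation-numeral : ∀ {r} → Number (PermutationList r)
    permutation-numeral {r} = record
      -- Each literal is accepted only if its digits are checked to be a permutation of 1 to `r`.
      { Constraint = λ m → True (permutationList? (digits r m))
      ; fromNat    = λ m {{p}} → digits r m , [ toWitness p ]
      }

-- Named because 4 and 5 would themselves be overloaded where Numerals is open.
Pattern₄ Permutation₅ : Set
Pattern₄     = Vec ℕ 4
Permutation₅ = PermutationList 5

module _ where

  open Numerals

  -- Both lists were found by computer search.

  order : List Pattern₄
  order =
    3124 ∷ 4123 ∷ 4132 ∷ 1234 ∷ 1243 ∷ 1432 ∷ 2341 ∷ 1342 ∷ 3421 ∷ 2314 ∷ 2431 ∷ 4321 ∷
    4213 ∷ 3214 ∷ 1324 ∷ 2143 ∷ 4312 ∷ 3241 ∷ 3142 ∷ 1423 ∷ 3412 ∷ 4231 ∷ 2134 ∷ 2413 ∷ []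

  packing : List (List⁺ Permutation₅)
  packing =
    (12345 ∷ []) ∷
    (54321 ∷ []) ∷
    (13254 ∷ 21435 ∷ []) ∷
    (14253 ∷ 31425 ∷ []) ∷
    (15243 ∷ 51423 ∷ []) ∷
    (32415 ∷ 34251 ∷ []) ∷
    (35241 ∷ 52413 ∷ []) ∷
    (45231 ∷ 53412 ∷ []) ∷
    (12435 ∷ 13245 ∷ 21354 ∷ []) ∷
    (12534 ∷ 15234 ∷ 51243 ∷ []) ∷
    (14325 ∷ 43152 ∷ 41532 ∷ []) ∷
    (14523 ∷ 45123 ∷ 51342 ∷ []) ∷
    (15324 ∷ 52143 ∷ 31542 ∷ []) ∷
    (23145 ∷ 32451 ∷ 23415 ∷ []) ∷
    (24315 ∷ 42153 ∷ 32541 ∷ []) ∷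
    (24513 ∷ 35124 ∷ 52341 ∷ []) ∷
    (25314 ∷ 53142 ∷ 42531 ∷ []) ∷
    (25413 ∷ 54132 ∷ 52431 ∷ []) ∷
    (34125 ∷ 42351 ∷ 34512 ∷ []) ∷
    (43521 ∷ 45213 ∷ 53241 ∷ []) ∷
    (45312 ∷ 54231 ∷ 53421 ∷ []) ∷
    (12453 ∷ 13524 ∷ 25134 ∷ 41235 ∷ []) ∷
    (12543 ∷ 15423 ∷ 43125 ∷ 31254 ∷ []) ∷
    (13452 ∷ 23514 ∷ 24135 ∷ 31245 ∷ []) ∷
    (14352 ∷ 43512 ∷ 45132 ∷ 41325 ∷ []) ∷
    (14532 ∷ 34215 ∷ 32145 ∷ 21453 ∷ []) ∷
    (15342 ∷ 42315 ∷ 23154 ∷ 21534 ∷ []) ∷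
    (21543 ∷ 25431 ∷ 53214 ∷ 32154 ∷ []) ∷
    (24153 ∷ 31524 ∷ 25341 ∷ 52314 ∷ []) ∷
    (24351 ∷ 42513 ∷ 35142 ∷ 51324 ∷ []) ∷
    (12354 ∷ 23541 ∷ 35412 ∷ 54123 ∷ 51234 ∷ []) ∷
    (13425 ∷ 34152 ∷ 41523 ∷ 14235 ∷ 41352 ∷ []) ∷
    (13542 ∷ 35421 ∷ 54312 ∷ 53124 ∷ 41253 ∷ []) ∷
    (21345 ∷ 23451 ∷ 34521 ∷ 35214 ∷ 52134 ∷ []) ∷
    (24531 ∷ 45321 ∷ 54213 ∷ 42135 ∷ 31452 ∷ []) ∷
    (15432 ∷ 43215 ∷ 43251 ∷ 32514 ∷ 25143 ∷ 51432 ∷ []) ∷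
    []

vertices : VertexSet (PSG 5)
vertices .elements = permutationLists 5
vertices .distinct = from-yes (unique? (permutationLists 5))
  where open DecUnique _≟ᴾ_ using (unique?)

-- The positions in `order` of the two ends of the arc `a`. The four entries need no relabelling to
-- 1 to 4, since `rank` compares by pattern.
source target : Permutation₅ → ℕ
source a = rank order (init (value a))
target a = rank order (tail (value a))

non-ascents : VertexSet (PSG 5)
-- The comparison is non-strict, so the two loops, at 12345 and 54321, are included.
non-ascents .elements = filter (λ a → target a ≤? source a) (permutationLists 5)
non-ascents .distinct = Unique.filter⁺ (λ a → target a ≤? source a) (distinct vertices)

-- An edge from `a` to `b` is a match of the tail of `a` with the init of `b`, so `rank-cong`
-- equates `target a` with `source b`, as `non-ascent` requires.
non-ascents-hit : HitsAllCycles (PSG 5) non-ascents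
non-ascents-hit c cycle = Any.map (∈-filter⁺ (λ a → target a ≤? source a) (∈-permutationLists _))
  (non-ascent {f = source} {g = target} (λ {a} {b} → rank-cong order (tail (value a)) (init (value b))) c cycle)

packing-cycles : All (IsCycle (PSG 5)) packing
packing-cycles = from-yes (All.all? isCycle? packing)

-- Checked by evaluation. The cycle lengths add up to 120, so the packing even partitions the
-- vertices.
packing-disjoint : Unique (concatMap toList packing)
packing-disjoint = from-yes (unique? (concatMap toList packing))
  where open DecUnique _≟ᴾ_ using (unique?)

τ≡36 : τ[ PSG 5 ]≡ 36
-- Here `refl` evaluates the filter over all permutations and counts 36 non-ascents; the length of
-- `packing` evaluates to 36 as well.
τ≡36 = (non-ascents , non-ascents-hit , refl) , packing-bound _≟ᴾ_ packing-cycles packing-disjoint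

proposition30 : (τ[ PSG 5 ]≡ 36) × (a[ PSG 5 ]≡ (5 ! ∸ 36)) × (5 ! ∸ 36 ≡ 84)
-- The bound comes as `size vertices ∸ 36`; `size vertices` and `5 !` both evaluate to 120.
proposition30 = τ≡36 , Complement.τ⇒a _≟ᴾ_ vertices ∈-permutationLists τ≡36 , refl
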